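{- Let $d\ge 1$ and $k\ge 2$ be integers, and set $$\eta_d(k)=\sum_{i=0}^{d}\binom{k-2}{i}.$$ Let $X$ be a finite subset of $\mathbb{R}^d$, and suppose that each point of $X$ is painted with one of $k$ colors. If every subset of $X$ with at most $(d+1)\cdot\eta_d(k)+k$ points can be partitioned by hyperplanes along the colors, then $X$ itself can be partitioned by hyperplanes along the colors.
   Context: A hyperplane $h$ in $\mathbb{R}^d$ has two associated open halfspaces $h^+$ and $h^-$; it separates two points if one lies in $h^+$ and the other lies in $h^-$. Let $X\subset\mathbb{R}^d$ be a finite set each of whose points is painted with one of $k$ colors. A subset $S$ of $X$ can be partitioned by hyperplanes along the colors if there is a family $\mathcal{F}$ of hyperplanes such that: (1) every hyperplane in $\mathcal{F}$ avoids the points of $S$ (contains no point of $S$); (2) for any two points of $S$ with different colors, there is a hyperplane in $\mathcal{F}$ separating them; (3) no hyperplane in $\mathcal{F}$ separates points of $S$ with the same color. Binomial coefficients $\binom{n}{i}$ with $0\le n<i$ are $0$. -}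

module Defs where

open import Algebra.Bundles using (CommutativeRing)
open import Algebra.Definitions.RawMonoid using (sum)
open import Data.Fin.Base using (Fin)
open import Data.Fin.Subset using (Subset; _∈_)
import Data.List.Base as List
open import Data.Nat.Base using (ℕ; suc; _∸_)
open import Data.Nat.Combinatorics using (_C_)
open import Data.Nat.ListAction using () renaming (sum to sumℕ)
open import Data.Product.Base using (Σ; ∃; ∃-syntax; _×_)
open import Data.Sum.Base using (_⊎_)
open import Data.Vec.Functional using (Vector; zipWith)
import Data.Vec.Functional.Relation.Binary.Equality.Setoid as VecEq
open import Level using (Level; _⊔_) renaming (suc to lsuc)
open import Relation.Binary.Core using (Rel)
open import Relation.Binary.PropositionalEquality.Core using (_≡_; _≢_)
open import Relation.Binary.Structures using (IsStrictTotalOrder)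
open import Relation.Nullary.Negation.Core using (¬_)
open import Relation.Unary using (Pred)

-- The real numbers, axiomatised classically as a complete ordered field.
-- These axioms determine ℝ up to isomorphism.  They are meant classically:
-- the order is trichotomous, and every inhabited set that is bounded above
-- has a least upper bound.
record Reals c ℓ₁ ℓ₂ : Set (lsuc (c ⊔ ℓ₁ ⊔ ℓ₂)) where
  field
    commutativeRing : CommutativeRing c ℓ₁

  open CommutativeRing commutativeRing public

  infix 4 _<_
  field
    _<_                : Rel Carrier ℓ₂
    isStrictTotalOrder : IsStrictTotalOrder _≈_ _<_
    0≉1                : ¬ 0# ≈ 1#
    inverse            : ∀ x → ¬ x ≈ 0# → ∃[ y ] x * y ≈ 1#
    +-monoˡ-<          : ∀ z {x y} → x < y → x + z < y + z
    *-pos              : ∀ {x y} → 0# < x → 0# < y → 0# < x * y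

  UpperBound : ∀ {p} → Pred Carrier p → Pred Carrier (c ⊔ ℓ₂ ⊔ p)
  UpperBound P u = ∀ x → P x → ¬ u < x

  field
    supremum : (P : Pred Carrier (c ⊔ ℓ₁ ⊔ ℓ₂)) → ∃ P → ∃ (UpperBound P) →
               ∃[ s ] UpperBound P s × (∀ u → UpperBound P u → ¬ u < s)

module Geometry {c ℓ₁ ℓ₂ : Level} (ℝ : Reals c ℓ₁ ℓ₂) where

  open Reals ℝ using (Carrier; _≈_; _<_; 0#; _*_; setoid; +-rawMonoid)

  Point : ℕ → Set c
  Point d = Vector Carrier d

  infix 4 _≋_
  _≋_ : ∀ {d} → Rel (Point d) ℓ₁
  _≋_ = VecEq._≋_ setoid

  infix 8 _·_
  _·_ : ∀ {d} → Point d → Point d → Carrier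
  a · x = sum +-rawMonoid (zipWith _*_ a x)

  -- The hyperplane { x ∣ normal · x = offset }.
  record Hyperplane (d : ℕ) : Set (c ⊔ ℓ₁) where
    field
      normal   : Point d
      offset   : Carrier
      normal≉0 : ∃[ i ] ¬ normal i ≈ 0#

  module _ {d : ℕ} (h : Hyperplane d) where
    open Hyperplane h

    Contains : Pred (Point d) ℓ₁
    Contains x = normal · x ≈ offset

    Above Below : Pred (Point d) ℓ₂
    Above x = offset < normal · x
    Below x = normal · x < offset

    Separates : Rel (Point d) ℓ₂
    Separates x y = (Above x × Below y) ⊎ (Below x × Above y)

  -- The points X 0, …, X (n - 1) are coloured by their indices, and a subset
  -- of the point set is given by a set S of indices.
  module _ {d k n : ℕ} (X : Fin n → Point d) (colour : Fin n → Fin k)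
           (S : Subset n) where

    record PartitionsAlongColours {p} (F : Pred (Hyperplane d) p)
           : Set (c ⊔ ℓ₁ ⊔ ℓ₂ ⊔ p) where
      field
        avoids    : ∀ h → F h → ∀ i → i ∈ S → ¬ Contains h (X i)
        separates : ∀ i j → i ∈ S → j ∈ S → colour i ≢ colour j →
                    ∃[ h ] F h × Separates h (X i) (X j)
        respects  : ∀ h → F h → ∀ i j → i ∈ S → j ∈ S →
                    colour i ≡ colour j → ¬ Separates h (X i) (X j)

    CanBePartitioned : Set (lsuc (c ⊔ ℓ₁ ⊔ ℓ₂))
    CanBePartitioned =
      Σ (Pred (Hyperplane d) (c ⊔ ℓ₁ ⊔ ℓ₂)) PartitionsAlongColours

η : ℕ → ℕ → ℕ
η d k = sumℕ (List.map ((k ∸ 2) C_) (List.upTo (suc d)))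

{-# OPTIONS --safe #-}
module Submission where

-- Suppose that no hyperplane respecting all colours separates colours a and b, and
-- pick a representative of each colour.  A hyperplane with a above and b below
-- prescribes signs for the other k - 2 colours.  Every prescription fails on X, and
-- by a Kirchberger theorem in which one constraint (the representative of a) is
-- fixed in advance, it already fails on d + 1 further points of X.  Collect these
-- points for the prescriptions that are realised on the representatives, and add the
-- representatives: no hyperplane partitions the resulting set.  The realised
-- prescriptions shatter no d + 1 colours, since given a point and d + 1 others in
-- ℝᵈ, hyperplanes with the former above miss some sign pattern on the latter; hence
-- by the Sauer–Shelah lemma there are at most η d k of them.  Points of ℝᵈ are
-- homogenised, so that hyperplanes become linear forms, and both geometric facts
-- are proved by induction on the dimension, eliminating a coordinate.

open import Defs
open import Data.Fin.Base using (Fin)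
open import Data.Fin.Subset using (Subset; ∣_∣; ⊤)
open import Function.Definitions using (Injective)
open import Relation.Binary.PropositionalEquality.Core using (_≡_)

import Algebra.Properties.CommutativeMonoid.Sum as MonoidSum
import Algebra.Properties.Ring as RingProperties
import Algebra.Properties.Semiring.Sum as SemiringSum
import Algebra.Solver.Ring.NaturalCoefficients.Default as SemiringSolver
open import Data.Bool.Base using (Bool; true; false; _∧_; _∨_; if_then_else_)
open import Data.Empty using (⊥; ⊥-elim)
open import Data.Fin.Base using (zero; suc; punchIn; punchOut)
open import Data.Fin.Properties using (any?; _≟_; punchIn-punchOut)
open import Data.Fin.Subset using (_∈_; _⊆_; _∪_; ⁅_⁆; inside; outside) renaming (⊥ to ∅)
open import Data.Fin.Subset.Properties using (∣⊥∣≡0; ∣⁅x⁆∣≡1; x∈⁅x⁆; p⊆p∪q; q⊆p∪q)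
import Data.List.Base as List
open import Data.List.Properties using (upTo-∷ʳ; map-++)
import Data.Nat.Base as ℕ
open import Data.Nat.Base using (ℕ; zero; suc; z≤n; s≤s)
open import Data.Nat.Combinatorics using (_C_; nCk+nC[k+1]≡[n+1]C[k+1])
open import Data.Nat.ListAction using () renaming (sum to sumℕ)
open import Data.Nat.ListAction.Properties using (sum-++)
import Data.Nat.Properties as ℕₚ
open import Data.Nat.Tactic.RingSolver using (solve-∀)
open import Data.Product.Base using (Σ; ∃; ∃-syntax; _×_; _,_; proj₁; proj₂)
open import Data.Sum.Base using (_⊎_; inj₁; inj₂)
open import Data.Vec.Base as Vec using (Vec; lookup; here; there)
open import Data.Vec.Functional using (Vector; map; insertAt; removeAt; tail; head)
open import Data.Vec.Functional.Properties using (insertAt-lookup; insertAt-punchIn)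
open import Data.Vec.Properties using (lookup∘tabulate)
open import Level using (Lift; lift; _⊔_)
open import Relation.Binary.Definitions using (tri<; tri≈; tri>)
open import Relation.Binary.PropositionalEquality as ≡ using (_≢_)
import Relation.Binary.Reasoning.Setoid as SetoidReasoning
open import Relation.Binary.Structures using (IsStrictTotalOrder)
open import Relation.Nullary.Decidable using (Dec; yes; no; does; dec-true)
open import Relation.Nullary.Negation.Core using (¬_; contradiction)

-- Combinatorics of binomial sums, sign patterns and finite subsets.

module Counting where
  open import Data.Nat.Base using (_+_; _*_; _≤_)
  open import Data.Vec.Base using ([]; _∷_)
  open ≡ using (refl; sym; cong; cong₂; module ≡-Reasoning)

  -- The second argument is the number of terms, so `η d k` unfolds to `binomials (k ∸ 2) (suc d)`.
  binomials : ℕ → ℕ → ℕ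
  binomials m e = sumℕ (List.map (m C_) (List.upTo e))

  binomials-suc : ∀ m e → binomials m (suc e) ≡ binomials m e + m C e
  binomials-suc m e = begin
    sumℕ (List.map (m C_) (List.upTo (suc e)))
      ≡⟨ cong (λ l → sumℕ (List.map (m C_) l)) (upTo-∷ʳ e) ⟨
    sumℕ (List.map (m C_) (List.upTo e List.∷ʳ e))
      ≡⟨ cong sumℕ (map-++ (m C_) (List.upTo e) _) ⟩
    sumℕ (List.map (m C_) (List.upTo e) List.∷ʳ m C e)
      ≡⟨ sum-++ (List.map (m C_) (List.upTo e)) _ ⟩
    binomials m e + (m C e + 0)
      ≡⟨ cong (binomials m e +_) (ℕₚ.+-identityʳ _) ⟩
    binomials m e + m C e ∎
    where open ≡-Reasoning

  -- Pascal's rule summed over all terms; this is the recurrence behind the Sauer-Shelah bound.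
  binomials-pascal : ∀ m e →
    binomials (suc m) (suc e) ≡ binomials m (suc e) + binomials m e
  binomials-pascal m zero    = refl
  binomials-pascal m (suc e) = begin
    binomials (suc m) (suc (suc e))
      ≡⟨ binomials-suc (suc m) (suc e) ⟩
    binomials (suc m) (suc e) + suc m C suc e
      ≡⟨ cong₂ _+_ (binomials-pascal m e) (sym (nCk+nC[k+1]≡[n+1]C[k+1] m e)) ⟩
    binomials m (suc e) + binomials m e + (m C e + m C suc e)
      ≡⟨ shuffle (binomials m (suc e)) (binomials m e) (m C e) (m C suc e) ⟩
    binomials m (suc e) + m C suc e + (binomials m e + m C e)
      ≡⟨ cong₂ _+_ (binomials-suc m (suc e)) (binomials-suc m e) ⟨
    binomials m (suc (suc e)) + binomials m (suc e) ∎
    where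
    open ≡-Reasoning
    shuffle : ∀ w x y z → w + x + (y + z) ≡ w + z + (x + y)
    shuffle = solve-∀

  -- Families of sign patterns and the Sauer-Shelah lemma.

  after : ∀ {a} {A : Set a} {m} → Bool → (Vec Bool (suc m) → A) → Vec Bool m → A
  after b f τ = f (b ∷ τ)

  Family : ℕ → Set
  Family m = Vec Bool m → Bool

  count : ∀ {m} → Family m → ℕ
  count {zero}  D = if D [] then 1 else 0
  count {suc m} D = count (after true D) + count (after false D)

  -- Inclusion-exclusion, to be applied to the two halves of a family cut by its first coordinate.
  count-∨-∧ : ∀ {m} (D E : Family m) →
    count D + count E ≡ count (λ τ → D τ ∨ E τ) + count (λ τ → D τ ∧ E τ)
  count-∨-∧ {zero} D E with D [] | E []
  ... | true  | true  = refl
  ... | true  | false = refl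
  ... | false | true  = refl
  ... | false | false = refl
  count-∨-∧ {suc m} D E = begin
    count Dₜ + count Df + (count Eₜ + count Ef)
      ≡⟨ shuffle (count Dₜ) (count Df) (count Eₜ) (count Ef) ⟩
    count Dₜ + count Eₜ + (count Df + count Ef)
      ≡⟨ cong₂ _+_ (count-∨-∧ Dₜ Eₜ) (count-∨-∧ Df Ef) ⟩
    count (λ τ → Dₜ τ ∨ Eₜ τ) + count (λ τ → Dₜ τ ∧ Eₜ τ) +
    (count (λ τ → Df τ ∨ Ef τ) + count (λ τ → Df τ ∧ Ef τ))
      ≡⟨ shuffle (count (λ τ → Dₜ τ ∨ Eₜ τ)) _ _ _ ⟩
    count (λ τ → Dₜ τ ∨ Eₜ τ) + count (λ τ → Df τ ∨ Ef τ) +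
    (count (λ τ → Dₜ τ ∧ Eₜ τ) + count (λ τ → Df τ ∧ Ef τ)) ∎
    where
    open ≡-Reasoning
    Dₜ Df Eₜ Ef : Family m
    Dₜ = after true D
    Df = after false D
    Eₜ = after true E
    Ef = after false E
    shuffle : ∀ w x y z → w + x + (y + z) ≡ w + y + (x + z)
    shuffle = solve-∀

  -- Injectivity of `ι` is automatic: two equal images could not realise different entries of `s`.
  Shatters : ∀ {m} → Family m → ℕ → Set
  Shatters {m} D e = Σ (Fin e → Fin m) λ ι →
    ∀ s → ∃[ τ ] D τ ≡ true × (∀ i → lookup τ (ι i) ≡ lookup s i)

  -- Split off the first coordinate. The union of the two halves shatters no `suc e` coordinates.
  -- Their intersection shatters no `e`, since whatever it shatters stays shattered by `D` when the
  -- first coordinate joins. `binomials-pascal` adds the two bounds.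
  sauer-shelah : ∀ {m} e (D : Family m) → ¬ Shatters D e → count D ≤ binomials m e
  sauer-shelah {zero} e D ¬sh with D [] in D[]
  ... | false = z≤n
  -- Any nonempty family shatters the empty set of coordinates.
  sauer-shelah {zero} zero    D ¬sh | true =
    ⊥-elim (¬sh ((λ ()) , λ _ → [] , D[] , λ ()))
  sauer-shelah {zero} (suc e) D ¬sh | true = s≤s z≤n
  sauer-shelah {suc m} zero D ¬sh =
    ℕₚ.+-mono-≤ (sauer-shelah zero _ (¬half true)) (sauer-shelah zero _ (¬half false))
    where
    ¬half : ∀ b → ¬ Shatters (after b D) zero
    ¬half b (_ , sh) = ¬sh ((λ ()) , λ s → let τ , Dτ , _ = sh s in b ∷ τ , Dτ , λ ())
  sauer-shelah {suc m} (suc e) D ¬sh = begin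
    count D                                 ≡⟨ count-∨-∧ Dₜ Df ⟩
    count (λ τ → Dₜ τ ∨ Df τ) + count (λ τ → Dₜ τ ∧ Df τ)
      ≤⟨ ℕₚ.+-mono-≤ (sauer-shelah (suc e) _ ¬∨) (sauer-shelah e _ ¬∧) ⟩
    binomials m (suc e) + binomials m e     ≡⟨ binomials-pascal m e ⟨
    binomials (suc m) (suc e)               ∎
    where
    open ℕₚ.≤-Reasoning
    Dₜ Df : Family m
    Dₜ = after true D
    Df = after false D

    ∨-true : ∀ τ → Dₜ τ ∨ Df τ ≡ true → ∃[ b ] D (b ∷ τ) ≡ true
    ∨-true τ eq with D (true ∷ τ) in Dτ
    ... | true  = true , Dτ
    ... | false = false , eq

    ∧-true : ∀ τ → Dₜ τ ∧ Df τ ≡ true → ∀ b → D (b ∷ τ) ≡ true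
    ∧-true τ eq true with D (true ∷ τ)
    ... | true = refl
    ∧-true τ eq false with D (true ∷ τ)
    ... | true = eq

    ¬∨ : ¬ Shatters (λ τ → Dₜ τ ∨ Df τ) (suc e)
    ¬∨ (ι , sh) = ¬sh ((λ i → suc (ι i)) , λ s →
      let τ , Dτ , eq = sh s ; b , Dbτ = ∨-true τ Dτ in b ∷ τ , Dbτ , eq)

    ¬∧ : ¬ Shatters (λ τ → Dₜ τ ∧ Df τ) e
    ¬∧ (ι , sh) = ¬sh (ι⁺ , sh⁺)
      where
      ι⁺ : Fin (suc e) → Fin (suc m)
      ι⁺ zero    = zero
      ι⁺ (suc i) = suc (ι i)
      sh⁺ : ∀ s → ∃[ τ ] D τ ≡ true × (∀ i → lookup τ (ι⁺ i) ≡ lookup s i)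
      sh⁺ (b ∷ s) = let τ , Dτ , eq = sh s in
        b ∷ τ , ∧-true τ Dτ b , λ { zero → refl ; (suc i) → eq i }

  -- Cardinalities of finite unions, and search through sign patterns.

  ∣∪∣≤∣∣+∣∣ : ∀ {n} (p q : Subset n) → ∣ p ∪ q ∣ ≤ ∣ p ∣ + ∣ q ∣
  ∣∪∣≤∣∣+∣∣ []            []            = z≤n
  ∣∪∣≤∣∣+∣∣ (outside ∷ p) (outside ∷ q) = ∣∪∣≤∣∣+∣∣ p q
  ∣∪∣≤∣∣+∣∣ (outside ∷ p) (inside  ∷ q) =
    ℕₚ.≤-trans (s≤s (∣∪∣≤∣∣+∣∣ p q)) (ℕₚ.≤-reflexive (sym (ℕₚ.+-suc ∣ p ∣ ∣ q ∣)))
  ∣∪∣≤∣∣+∣∣ (inside  ∷ p) (outside ∷ q) = s≤s (∣∪∣≤∣∣+∣∣ p q)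
  ∣∪∣≤∣∣+∣∣ (inside  ∷ p) (inside  ∷ q) =
    s≤s (ℕₚ.≤-trans (∣∪∣≤∣∣+∣∣ p q) (ℕₚ.+-monoʳ-≤ ∣ p ∣ (ℕₚ.n≤1+n ∣ q ∣)))

  image : ∀ {k n} → (Fin k → Fin n) → Subset n
  image {zero}  r = ∅
  image {suc k} r = ⁅ r zero ⁆ ∪ image (λ i → r (suc i))

  ∈-image : ∀ {k n} (r : Fin k → Fin n) i → r i ∈ image r
  ∈-image r zero    = p⊆p∪q _ (x∈⁅x⁆ (r zero))
  ∈-image r (suc i) = q⊆p∪q ⁅ r zero ⁆ _ (∈-image (λ i → r (suc i)) i)

  ∣image∣≤ : ∀ {k n} (r : Fin k → Fin n) → ∣ image r ∣ ≤ k
  ∣image∣≤ {zero}  {n} r = ℕₚ.≤-reflexive (∣⊥∣≡0 n)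
  ∣image∣≤ {suc k} {n} r = ℕₚ.≤-trans (∣∪∣≤∣∣+∣∣ ⁅ r zero ⁆ _)
    (ℕₚ.+-mono-≤ (ℕₚ.≤-reflexive (∣⁅x⁆∣≡1 (r zero))) (∣image∣≤ (λ i → r (suc i))))

  ⋃[_]_ : ∀ {m n} → Family m → (Vec Bool m → Subset n) → Subset n
  ⋃[_]_ {zero}  D Y = if D [] then Y [] else ∅
  ⋃[_]_ {suc m} D Y =
    (⋃[ after true D ] after true Y) ∪ (⋃[ after false D ] after false Y)

  ⊆-⋃ : ∀ {m n} (D : Family m) (Y : Vec Bool m → Subset n) τ →
    D τ ≡ true → Y τ ⊆ ⋃[ D ] Y
  ⊆-⋃ D Y []          eq rewrite eq = λ x∈ → x∈
  ⊆-⋃ D Y (true ∷ τ)  eq x∈ = p⊆p∪q _ (⊆-⋃ (after true D) (after true Y) τ eq x∈)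
  ⊆-⋃ D Y (false ∷ τ) eq x∈ =
    q⊆p∪q (⋃[ after true D ] after true Y) _
      (⊆-⋃ (after false D) (after false Y) τ eq x∈)

  ∣⋃∣≤ : ∀ {m n} (D : Family m) (Y : Vec Bool m → Subset n) {N} →
    (∀ τ → ∣ Y τ ∣ ≤ N) → ∣ ⋃[ D ] Y ∣ ≤ count D * N
  ∣⋃∣≤ {zero} {n} D Y Y≤N with D []
  ... | true  = ℕₚ.≤-trans (Y≤N []) (ℕₚ.≤-reflexive (sym (ℕₚ.*-identityˡ _)))
  ... | false = ℕₚ.≤-reflexive (∣⊥∣≡0 n)
  ∣⋃∣≤ {suc m} D Y {N} Y≤N = begin
    ∣ ⋃[ D ] Y ∣
      ≤⟨ ∣∪∣≤∣∣+∣∣ (⋃[ after true D ] after true Y) _ ⟩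
    ∣ ⋃[ after true D ] after true Y ∣ + ∣ ⋃[ after false D ] after false Y ∣
      ≤⟨ ℕₚ.+-mono-≤ (∣⋃∣≤ (after true D) (after true Y) (λ τ → Y≤N (true ∷ τ)))
                     (∣⋃∣≤ (after false D) (after false Y) (λ τ → Y≤N (false ∷ τ))) ⟩
    count (after true D) * N + count (after false D) * N
      ≡⟨ ℕₚ.*-distribʳ-+ N (count (after true D)) _ ⟨
    count D * N ∎
    where open ℕₚ.≤-Reasoning

  -- Source of the bound in the theorem: `suc d` points for each pattern in `D`, and one
  -- representative per colour.
  ∣⋃∪image∣≤ : ∀ {m n k} (D : Family m) (Y : Vec Bool m → Subset n) (r : Fin k → Fin n)
    {d N} → (∀ τ → ∣ Y τ ∣ ≤ suc d) → count D ≤ N →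
    ∣ (⋃[ D ] Y) ∪ image r ∣ ≤ (d + 1) * N + k
  ∣⋃∪image∣≤ {k = k} D Y r {d} {N} Y≤ D≤ = begin
    ∣ (⋃[ D ] Y) ∪ image r ∣      ≤⟨ ∣∪∣≤∣∣+∣∣ (⋃[ D ] Y) (image r) ⟩
    ∣ ⋃[ D ] Y ∣ + ∣ image r ∣    ≤⟨ ℕₚ.+-mono-≤ (∣⋃∣≤ D Y Y≤) (∣image∣≤ r) ⟩
    count D * suc d + k           ≤⟨ ℕₚ.+-monoˡ-≤ k (ℕₚ.*-monoˡ-≤ (suc d) D≤) ⟩
    N * suc d + k                 ≡⟨ cong (_+ k) (ℕₚ.*-comm N (suc d)) ⟩
    suc d * N + k                 ≡⟨ cong (λ e → e * N + k) (ℕₚ.+-comm 1 d) ⟩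
    (d + 1) * N + k               ∎
    where open ℕₚ.≤-Reasoning

  -- There are finitely many patterns, so all can be inspected. Later `P` is realisability and `Q`
  -- an obstruction to it.
  search : ∀ {m p q} {P : Vec Bool m → Set p} {Q : Vec Bool m → Set q} →
    (∀ τ → P τ ⊎ Q τ) → ∃ P ⊎ (∀ τ → Q τ)
  search {zero} P⊎Q with P⊎Q []
  ... | inj₁ p = inj₁ ([] , p)
  ... | inj₂ q = inj₂ λ { [] → q }
  search {suc m} P⊎Q with search (λ τ → P⊎Q (true ∷ τ)) | search (λ τ → P⊎Q (false ∷ τ))
  ... | inj₁ (τ , p) | _            = inj₁ (true ∷ τ , p)
  ... | inj₂ _       | inj₁ (τ , p) = inj₁ (false ∷ τ , p)
  ... | inj₂ qₜ      | inj₂ qf      = inj₂ λ { (true ∷ τ) → qₜ τ ; (false ∷ τ) → qf τ }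

open Counting

-- Every position is `i` or some `punchIn i j`. Two applications split the colours into the two to
-- be separated and the rest.
insertAt-elim : ∀ {a p} {A : Set a} {n} (P : Fin (suc n) → A → Set p)
  (xs : Vector A n) i v → P i v → (∀ j → P (punchIn i j) (xs j)) →
  ∀ j → P j (insertAt xs i v j)
insertAt-elim P xs zero v Pv Pxs zero    = Pv
insertAt-elim P xs zero v Pv Pxs (suc j) = Pxs j
insertAt-elim {n = suc n} P xs (suc i) v Pv Pxs zero    = Pxs zero
insertAt-elim {n = suc n} P xs (suc i) v Pv Pxs (suc j) =
  insertAt-elim (λ j → P (suc j)) (tail xs) i v Pv (λ j → Pxs (suc j)) j

module LinearInequalities {c ℓ₁ ℓ₂} (ℝ : Reals c ℓ₁ ℓ₂) where
  open import Data.Vec.Functional using (_∷_)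
  open Reals ℝ hiding (zero)
  open Geometry ℝ
  open IsStrictTotalOrder isStrictTotalOrder
    using (compare; irrefl; _<?_; <-respʳ-≈; <-respˡ-≈) renaming (trans to <-trans; _≟_ to _≈?_)
  open RingProperties ring
    using (-‿distribˡ-*; -‿distribʳ-*; -‿involutive; -0#≈0#; +-inverseʳ-unique; -‿+-comm)
  open MonoidSum +-commutativeMonoid using (sum-remove; sum-cong-≋; ∑-distrib-+; sum-replicate-zero)
  open SemiringSum semiring using (*-distribˡ-sum)
  open SemiringSolver commutativeSemiring using (solve; _:=_; _:+_; _:*_)
  open SetoidReasoning setoid

  -- Signs in an ordered field.

  +-pos : ∀ {x y} → 0# < x → 0# < y → 0# < x + y
  +-pos {x} {y} 0<x 0<y =
    <-trans 0<y (<-respˡ-≈ (+-identityˡ y) (+-monoˡ-< y 0<x))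

  neg-pos : ∀ {x} → x < 0# → 0# < - x
  neg-pos {x} x<0 =
    <-respʳ-≈ (+-identityˡ (- x)) (<-respˡ-≈ (-‿inverseʳ x) (+-monoˡ-< (- x) x<0))

  ¬pos-both : ∀ {x} → 0# < x → 0# < - x → ⊥
  ¬pos-both {x} 0<x 0<-x = irrefl refl (<-respʳ-≈ (-‿inverseʳ x) (+-pos 0<x 0<-x))

  -- Negativity is stated as positivity of `- x`, which lets `signed` treat both strict signs
  -- uniformly.
  data Trichotomy (x : Carrier) : Set (ℓ₁ ⊔ ℓ₂) where
    positive : 0# < x → Trichotomy x
    null     : x ≈ 0# → Trichotomy x
    negative : 0# < - x → Trichotomy x

  trichotomy : ∀ x → Trichotomy x
  trichotomy x with compare 0# x
  ... | tri< 0<x _ _ = positive 0<x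
  ... | tri≈ _ 0≈x _ = null (sym 0≈x)
  ... | tri> _ _ x<0 = negative (neg-pos x<0)

  square-pos : ∀ {x} → ¬ x ≈ 0# → 0# < x * x
  square-pos {x} x≉0 with trichotomy x
  ... | positive 0<x  = *-pos 0<x 0<x
  ... | null x≈0      = contradiction x≈0 x≉0
  ... | negative 0<-x = <-respʳ-≈ (begin
      - x * - x      ≈⟨ -‿distribˡ-* x (- x) ⟨
      - (x * - x)    ≈⟨ -‿cong (-‿distribʳ-* x x) ⟨
      - - (x * x)    ≈⟨ -‿involutive (x * x) ⟩
      x * x          ∎) (*-pos 0<-x 0<-x)

  0<1 : 0# < 1#
  0<1 = <-respʳ-≈ (*-identityˡ 1#) (square-pos (λ 1≈0 → 0≉1 (sym 1≈0)))

  signed : Bool → Carrier → Carrier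
  signed true  x = x
  signed false x = - x

  signed-cong : ∀ b {x y} → x ≈ y → signed b x ≈ signed b y
  signed-cong true  x≈y = x≈y
  signed-cong false x≈y = -‿cong x≈y

  *-signed : ∀ b x y → x * signed b y ≈ signed b (x * y)
  *-signed true  x y = refl
  *-signed false x y = sym (-‿distribʳ-* x y)

  signed-linear : ∀ b s x t y →
    signed b (s * x + t * y) ≈ s * signed b x + t * signed b y
  signed-linear true  s x t y = refl
  signed-linear false s x t y = begin
    - (s * x + t * y)        ≈⟨ -‿+-comm _ _ ⟨
    - (s * x) + - (t * y)    ≈⟨ +-cong (-‿distribʳ-* s x) (-‿distribʳ-* t y) ⟩
    s * - x + t * - y        ∎

  -- Linear combinations and linear forms.

  infixr 9 _•_⊕_•_
  _•_⊕_•_ : ∀ {D} → Carrier → Point D → Carrier → Point D → Point D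
  (s • x ⊕ t • y) i = s * x i + t * y i

  ·-linearˡ : ∀ {D} s (x : Point D) t y (v : Point D) →
    (s • x ⊕ t • y) · v ≈ s * (x · v) + t * (y · v)
  ·-linearˡ s x t y v = begin
    (s • x ⊕ t • y) · v
      ≈⟨ sum-cong-≋ (λ i → trans (distribʳ (v i) _ _)
                             (+-cong (*-assoc s _ _) (*-assoc t _ _))) ⟩
    _ ≈⟨ ∑-distrib-+ (λ i → s * (x i * v i)) (λ i → t * (y i * v i)) ⟩
    _ ≈⟨ +-cong (*-distribˡ-sum s (λ i → x i * v i)) (*-distribˡ-sum t (λ i → y i * v i)) ⟨
    s * (x · v) + t * (y · v) ∎

  ·-comm : ∀ {D} (x v : Point D) → x · v ≈ v · x
  ·-comm x v = sum-cong-≋ (λ i → *-comm (x i) (v i))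

  ·-linearʳ : ∀ {D} (x : Point D) s u t v →
    x · (s • u ⊕ t • v) ≈ s * (x · u) + t * (x · v)
  ·-linearʳ x s u t v = begin
    x · (s • u ⊕ t • v)        ≈⟨ ·-comm x (s • u ⊕ t • v) ⟩
    (s • u ⊕ t • v) · x        ≈⟨ ·-linearˡ s u t v x ⟩
    s * (u · x) + t * (v · x)  ≈⟨ +-cong (*-congˡ (·-comm u x)) (*-congˡ (·-comm v x)) ⟩
    s * (x · u) + t * (x · v)  ∎

  ·-zeroʳ : ∀ {D} (x : Point D) {v : Point D} → (∀ i → v i ≈ 0#) → x · v ≈ 0#
  ·-zeroʳ {D} x v≈0 =
    trans (sum-cong-≋ (λ i → trans (*-congˡ (v≈0 i)) (zeroʳ (x i)))) (sum-replicate-zero D)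

  ·-signed : ∀ {D} b (x v : Point D) → x · map (signed b) v ≈ signed b (x · v)
  ·-signed true  x v = refl
  ·-signed false x v = +-inverseʳ-unique _ _ (begin
    x · v + x · map -_ v
      ≈⟨ ∑-distrib-+ (λ i → x i * v i) (λ i → x i * - v i) ⟨
    _ ≈⟨ sum-cong-≋ (λ i → trans (sym (distribˡ (x i) _ _)) (*-congˡ (-‿inverseʳ (v i)))) ⟩
    _ ≈⟨ ·-zeroʳ x {λ _ → 0#} (λ _ → refl) ⟩
    0# ∎)

  insertAt-· : ∀ {D} (y : Point D) j t v →
    insertAt y j t · v ≈ t * v j + y · removeAt v j
  insertAt-· y j t v = begin
    insertAt y j t · v
      ≈⟨ sum-remove {i = j} (λ i → insertAt y j t i * v i) ⟩
    insertAt y j t j * v j + removeAt (insertAt y j t) j · removeAt v j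
      ≈⟨ +-cong (*-congʳ (reflexive (insertAt-lookup y j t)))
                (sum-cong-≋ (λ i → *-congʳ (reflexive (insertAt-punchIn y j t i)))) ⟩
    t * v j + y · removeAt v j ∎

  -- Eliminating a coordinate on a hyperplane through the origin.

  nonzero-or-zero : ∀ {D} (v : Point D) → (∃[ j ] ¬ v j ≈ 0#) ⊎ (∀ j → v j ≈ 0#)
  nonzero-or-zero {zero}  v = inj₂ λ ()
  nonzero-or-zero {suc D} v with v zero ≈? 0# | nonzero-or-zero (tail v)
  ... | no v₀≉0  | _               = inj₁ (zero , v₀≉0)
  ... | yes _    | inj₁ (j , vⱼ≉0) = inj₁ (suc j , vⱼ≉0)
  ... | yes v₀≈0 | inj₂ v≈0        = inj₂ λ { zero → v₀≈0 ; (suc j) → v≈0 j }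

  nonzero⇒positive : ∀ {D} (v : Point (suc D)) j → ¬ v j ≈ 0# → ∃[ w ] 0# < w · v
  nonzero⇒positive {D} v j vⱼ≉0 = insertAt (λ _ → 0#) j (v j) , <-respʳ-≈ (begin
    v j * v j                                ≈⟨ +-identityʳ _ ⟨
    v j * v j + 0#                           ≈⟨ +-congˡ 0·v≈0 ⟨
    v j * v j + (λ _ → 0#) · removeAt v j    ≈⟨ insertAt-· (λ _ → 0#) j (v j) v ⟨
    insertAt (λ _ → 0#) j (v j) · v          ∎) (square-pos vⱼ≉0)
    where
    0·v≈0 : (λ _ → 0#) · removeAt v j ≈ 0#
    0·v≈0 = trans (·-comm (λ _ → 0#) (removeAt v j)) (·-zeroʳ (removeAt v j) {λ _ → 0#} (λ _ → refl))

  -- If v j is nonzero, embed v j parametrises the hyperplane { x ∣ x · v ≈ 0# }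
  -- by the coordinates other than j, and restrict v j expresses linear forms on
  -- it in these coordinates, up to the positive factor v j * v j.
  restrict : ∀ {D} → Point (suc D) → Fin (suc D) → Point (suc D) → Point D
  restrict v j u = (v j * v j) • removeAt u j ⊕ (- (v j * u j)) • removeAt v j

  embed : ∀ {D} → Point (suc D) → Fin (suc D) → Point D → Point (suc D)
  embed v j y = insertAt (map ((v j * v j) *_) y) j (- (v j * (y · removeAt v j)))

  -- `embed v j` and `restrict v j` are transposes of each other.
  embed-· : ∀ {D} v j (y : Point D) u → embed v j y · u ≈ y · restrict v j u
  embed-· {D} v j y u = begin
    embed v j y · u
      ≈⟨ insertAt-· _ j _ u ⟩
    - (v j * B) * u j + map ((v j * v j) *_) y · removeAt u j
      ≈⟨ +-cong eq₁ eq₂ ⟩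
    - (v j * u j) * B + (v j * v j) * A
      ≈⟨ +-comm _ _ ⟩
    (v j * v j) * A + - (v j * u j) * B
      ≈⟨ ·-linearʳ y _ (removeAt u j) _ (removeAt v j) ⟨
    y · restrict v j u ∎
    where
    A = y · removeAt u j
    B = y · removeAt v j
    eq₁ : - (v j * B) * u j ≈ - (v j * u j) * B
    eq₁ = begin
      - (v j * B) * u j    ≈⟨ -‿distribˡ-* _ _ ⟨
      - (v j * B * u j)    ≈⟨ -‿cong (*-assoc _ _ _) ⟩
      - (v j * (B * u j))  ≈⟨ -‿cong (*-congˡ (*-comm _ _)) ⟩
      - (v j * (u j * B))  ≈⟨ -‿cong (*-assoc _ _ _) ⟨
      - (v j * u j * B)    ≈⟨ -‿distribˡ-* _ _ ⟩
      - (v j * u j) * B    ∎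
    eq₂ : map ((v j * v j) *_) y · removeAt u j ≈ (v j * v j) * A
    eq₂ = trans (sum-cong-≋ {D} (λ i → *-assoc (v j * v j) (y i) (removeAt u j i)))
                (sym (*-distribˡ-sum (v j * v j) (λ i → y i * removeAt u j i)))

  embed-⊥ : ∀ {D} v j (y : Point D) → embed v j y · v ≈ 0#
  embed-⊥ v j y = begin
    embed v j y · v                         ≈⟨ embed-· v j y v ⟩
    y · restrict v j v                      ≈⟨ ·-linearʳ y _ (removeAt v j) _ (removeAt v j) ⟩
    v j * v j * B + - (v j * v j) * B       ≈⟨ distribʳ B _ _ ⟨
    (v j * v j + - (v j * v j)) * B         ≈⟨ *-congʳ (-‿inverseʳ _) ⟩
    0# * B                                  ≈⟨ zeroˡ B ⟩
    0#                                      ∎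
    where B = y · removeAt v j

  -- Orthogonality gives `- B ≈ x j * v j`, which turns the second summand of `restrict` into the
  -- missing `j`-th term of `x · u`.
  removeAt-·-restrict : ∀ {D} v j (x : Point (suc D)) u → x · v ≈ 0# →
    removeAt x j · restrict v j u ≈ (v j * v j) * (x · u)
  removeAt-·-restrict v j x u x·v≈0 = begin
    removeAt x j · restrict v j u
      ≈⟨ ·-linearʳ (removeAt x j) _ (removeAt u j) _ (removeAt v j) ⟩
    v j * v j * A + - (v j * u j) * B
      ≈⟨ +-congˡ eq ⟩
    v j * v j * A + v j * v j * (x j * u j)
      ≈⟨ distribˡ _ _ _ ⟨
    (v j * v j) * (A + x j * u j)
      ≈⟨ *-congˡ (+-comm _ _) ⟩
    (v j * v j) * (x j * u j + A)
      ≈⟨ *-congˡ (sum-remove {i = j} (λ i → x i * u i)) ⟨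
    (v j * v j) * (x · u) ∎
    where
    A = removeAt x j · removeAt u j
    B = removeAt x j · removeAt v j
    -B≈xv : - B ≈ x j * v j
    -B≈xv = sym (+-inverseʳ-unique _ _ (begin
      B + x j * v j  ≈⟨ +-comm _ _ ⟩
      x j * v j + B  ≈⟨ sum-remove {i = j} (λ i → x i * v i) ⟨
      x · v          ≈⟨ x·v≈0 ⟩
      0#             ∎))
    eq : - (v j * u j) * B ≈ v j * v j * (x j * u j)
    eq = begin
      - (v j * u j) * B            ≈⟨ -‿distribˡ-* _ _ ⟨
      - (v j * u j * B)            ≈⟨ -‿distribʳ-* _ _ ⟩
      v j * u j * - B              ≈⟨ *-congˡ -B≈xv ⟩
      v j * u j * (x j * v j)      ≈⟨ *-congˡ (*-comm _ _) ⟩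
      v j * u j * (v j * x j)      ≈⟨ *-assoc _ _ _ ⟩
      v j * (u j * (v j * x j))    ≈⟨ *-congˡ (*-comm _ _) ⟩
      v j * (v j * x j * u j)      ≈⟨ *-congˡ (*-assoc _ _ _) ⟩
      v j * (v j * (x j * u j))    ≈⟨ *-assoc _ _ _ ⟨
      v j * v j * (x j * u j)      ∎

  restrict-pos : ∀ {D} v j (x : Point (suc D)) u b → ¬ v j ≈ 0# → x · v ≈ 0# →
    0# < signed b (x · u) → 0# < signed b (removeAt x j · restrict v j u)
  restrict-pos v j x u b vⱼ≉0 x·v≈0 pos = <-respʳ-≈ (begin
    (v j * v j) * signed b (x · u)    ≈⟨ *-signed b _ _ ⟩
    signed b ((v j * v j) * (x · u))  ≈⟨ signed-cong b (removeAt-·-restrict v j x u x·v≈0) ⟨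
    signed b (removeAt x j · restrict v j u) ∎) (*-pos (square-pos vⱼ≉0) pos)

  -- The segment from x to y meets the hyperplane { z ∣ z · v ≈ 0# }.
  crossing : ∀ {D} (v x y : Point D) → 0# < x · v → ¬ 0# < y · v →
    ∃[ z ] z · v ≈ 0# ×
      (∀ u b → 0# < signed b (x · u) → 0# < signed b (y · u) → 0# < signed b (z · u))
  crossing v x y 0<xv ¬0<yv with trichotomy (y · v)
  ... | positive 0<yv  = contradiction 0<yv ¬0<yv
  ... | null yv≈0      = y , yv≈0 , λ _ _ _ 0<yu → 0<yu
  ... | negative 0<-yv = z , z·v≈0 , λ u b 0<xu 0<yu → <-respʳ-≈ (begin
    - (y · v) * signed b (x · u) + (x · v) * signed b (y · u)
      ≈⟨ signed-linear b _ _ _ _ ⟨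
    signed b (- (y · v) * (x · u) + (x · v) * (y · u))
      ≈⟨ signed-cong b (·-linearˡ _ x _ y u) ⟨
    signed b (z · u) ∎) (+-pos (*-pos 0<-yv 0<xu) (*-pos 0<xv 0<yu))
    where
    -- Both weights are positive, and they are chosen so that the values of `v` at the two ends
    -- cancel.
    z = (- (y · v)) • x ⊕ (x · v) • y
    z·v≈0 : z · v ≈ 0#
    z·v≈0 = begin
      z · v                                    ≈⟨ ·-linearˡ _ x _ y v ⟩
      - (y · v) * (x · v) + (x · v) * (y · v)  ≈⟨ +-congˡ (*-comm _ _) ⟩
      - (y · v) * (x · v) + (y · v) * (x · v)  ≈⟨ distribʳ _ _ _ ⟨
      (- (y · v) + y · v) * (x · v)            ≈⟨ *-congʳ (-‿inverseˡ _) ⟩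
      0# * (x · v)                             ≈⟨ zeroˡ _ ⟩
      0#                                       ∎

  -- Small perturbations, and the two inductions on the dimension.

  dominate : ∀ {n} (α β : Fin n → Carrier) → (∀ i → 0# < α i) →
    ∃[ s ] ∃[ t ] 0# < s × 0# < t × (∀ i → 0# < s * α i + t * β i)
  dominate {zero}  α β 0<α = 1# , 1# , 0<1 , 0<1 , λ ()
  dominate {suc n} α β 0<α with dominate (tail α) (tail β) (λ i → 0<α (suc i)) | trichotomy (β zero)
  ... | s , t , 0<s , 0<t , pos | positive 0<β₀ = s , t , 0<s , 0<t ,
    λ { zero → +-pos (*-pos 0<s (0<α zero)) (*-pos 0<t 0<β₀) ; (suc i) → pos i }
  ... | s , t , 0<s , 0<t , pos | null β₀≈0 = s , t , 0<s , 0<t ,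
    λ { zero → <-respʳ-≈ (begin
          s * α zero                ≈⟨ +-identityʳ _ ⟨
          s * α zero + 0#           ≈⟨ +-congˡ (trans (*-congˡ β₀≈0) (zeroʳ t)) ⟨
          s * α zero + t * β zero   ∎) (*-pos 0<s (0<α zero))
      ; (suc i) → pos i }
  -- Scaling the old combination by `α₀` and adding `t * - β₀` times `α` keeps the other indices
  -- positive. At index zero the terms in `β₀` cancel and leave `s * α₀ * α₀`.
  ... | s , t , 0<s , 0<t , pos | negative 0<-β₀ =
    s * α₀ + t * - β₀ , t * α₀ ,
    +-pos (*-pos 0<s 0<α₀) (*-pos 0<t 0<-β₀) , *-pos 0<t 0<α₀ ,
    λ { zero → <-respʳ-≈ (begin
          s * α₀ * α₀                           ≈⟨ +-identityʳ _ ⟨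
          s * α₀ * α₀ + 0#                      ≈⟨ +-congˡ (trans (*-congˡ (-‿inverseˡ β₀)) (zeroʳ _)) ⟨
          s * α₀ * α₀ + t * α₀ * (- β₀ + β₀)    ≈⟨ solve 5 (λ s t a b -b →
            s :* a :* a :+ t :* a :* (-b :+ b) := (s :* a :+ t :* -b) :* a :+ t :* a :* b)
            refl s t α₀ β₀ (- β₀) ⟩
          (s * α₀ + t * - β₀) * α₀ + t * α₀ * β₀ ∎) (*-pos (*-pos 0<s 0<α₀) 0<α₀)
      ; (suc i) → <-respʳ-≈ (
          solve 6 (λ s t a -b aᵢ bᵢ →
            a :* (s :* aᵢ :+ t :* bᵢ) :+ t :* -b :* aᵢ :=
            (s :* a :+ t :* -b) :* aᵢ :+ t :* a :* bᵢ)
            refl s t α₀ (- β₀) (α (suc i)) (β (suc i)))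
          (+-pos (*-pos 0<α₀ (pos i)) (*-pos (*-pos 0<t 0<-β₀) (0<α (suc i)))) }
    where
    α₀ = α zero
    β₀ = β zero
    0<α₀ = 0<α zero

  -- For each pattern on the later `q i`, join a realiser that is positive on `q zero` to one that
  -- is negative there. The segment crosses the hyperplane of `q zero`, so the restricted forms are
  -- shattered one dimension lower. In dimension zero `p` cannot be positive. Without `p`, the
  -- coordinate forms would be shattered.
  no-shattering : ∀ {D} (p : Point D) (q : Fin D → Point D) →
    ¬ (∀ (s : Vec Bool D) → ∃[ x ] 0# < x · p × (∀ i → 0# < signed (lookup s i) (x · q i)))
  no-shattering {zero}  p q shattered =
    irrefl refl (proj₁ (proj₂ (shattered Vec.[])))
  no-shattering {suc D} p q shattered with nonzero-or-zero (q zero)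
  ... | inj₂ q₀≈0 = let x , _ , pos = shattered (Vec.replicate _ true) in
    irrefl refl (<-respʳ-≈ (·-zeroʳ x q₀≈0) (pos zero))
  ... | inj₁ (j , q₀ⱼ≉0) =
    no-shattering (restrict (q zero) j p) (λ i → restrict (q zero) j (q (suc i))) λ s →
      let x , xp , xq = shattered (true Vec.∷ s)
          y , yp , yq = shattered (false Vec.∷ s)
          z , z⊥q₀ , between = crossing (q zero) x y (xq zero) (λ 0<yv → ¬pos-both 0<yv (yq zero))
      in removeAt z j ,
         restrict-pos (q zero) j z p true q₀ⱼ≉0 z⊥q₀ (between p true xp yp) ,
         λ i → restrict-pos (q zero) j z (q (suc i)) (lookup s i) q₀ⱼ≉0 z⊥q₀
                 (between (q (suc i)) (lookup s i) (xq (suc i)) (yq (suc i)))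

  -- Add the constraints one at a time.  If the current solution x violates the new
  -- constraint v zero, then v zero is compatible with a set of old constraints
  -- satisfied at x only if that set has a solution on the hyperplane orthogonal to
  -- v zero, where the dimension is smaller.  Conversely, a solution on that
  -- hyperplane can be pushed slightly to its positive side.
  helly : ∀ {D n} (p : Point D) (v : Fin n → Point D) →
    (∃[ x ] 0# < x · p × (∀ i → 0# < x · v i)) ⊎
    (∃[ Y ] ∣ Y ∣ ℕ.≤ D × (∀ x → 0# < x · p → (∀ i → i ∈ Y → 0# < x · v i) → ⊥))
  -- Here `p` alone is unsatisfiable and no further constraint is charged, so the bound is `D`
  -- rather than `D + 1`.
  helly {zero} {n} p v =
    inj₂ (∅ , ℕₚ.≤-reflexive (∣⊥∣≡0 n) , λ x 0<0 _ → irrefl refl 0<0)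
  helly {suc D} {zero} p v with nonzero-or-zero p
  ... | inj₁ (j , pⱼ≉0) = let w , wp = nonzero⇒positive p j pⱼ≉0 in inj₁ (w , wp , λ ())
  ... | inj₂ p≈0 = inj₂ (∅ , z≤n , λ x xp _ → irrefl refl (<-respʳ-≈ (·-zeroʳ x p≈0) xp))
  helly {suc D} {suc n} p v with helly p (tail v)
  ... | inj₂ (Y , ∣Y∣≤ , inf) =
    inj₂ (outside Vec.∷ Y , ∣Y∣≤ , λ x xp xY → inf x xp (λ i i∈Y → xY (suc i) (there i∈Y)))
  ... | inj₁ (x , xp , xv) with 0# <? x · v zero
  ...   | yes xv₀ = inj₁ (x , xp , λ { zero → xv₀ ; (suc i) → xv i })
  ...   | no ¬xv₀ with nonzero-or-zero (v zero)
  ...     | inj₂ v₀≈0 = inj₂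
    ( inside Vec.∷ ∅
    , s≤s (ℕₚ.≤-trans (ℕₚ.≤-reflexive (∣⊥∣≡0 n)) z≤n)
    , λ y _ yv → irrefl refl (<-respʳ-≈ (·-zeroʳ y v₀≈0) (yv zero here)))
  ...     | inj₁ (j , v₀ⱼ≉0)
    with helly (restrict (v zero) j p) (λ i → restrict (v zero) j (v (suc i)))
  -- The new constraint pays for the lost dimension. A solution `y` of the enlarged set would cross
  -- the hyperplane on its way to `x`.
  ...       | inj₂ (Y , ∣Y∣≤ , inf) = inj₂ (inside Vec.∷ Y , s≤s ∣Y∣≤ , λ y yp yY →
    let z , z⊥v₀ , between = crossing (v zero) y x (yY zero here) ¬xv₀
    in inf (removeAt z j)
         (restrict-pos (v zero) j z p true v₀ⱼ≉0 z⊥v₀ (between p true yp xp))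
         (λ i i∈Y → restrict-pos (v zero) j z (v (suc i)) true v₀ⱼ≉0 z⊥v₀
           (between (v (suc i)) true (yY (suc i) (there i∈Y)) (xv i))))
  ...       | inj₁ (y , yp , yv) =
    let z = embed (v zero) j y
        w , wv₀ = nonzero⇒positive (v zero) j v₀ⱼ≉0
        forms = p ∷ tail v
        z-pos : ∀ i → 0# < z · forms i
        z-pos = λ { zero    → <-respʳ-≈ (sym (embed-· (v zero) j y p)) yp
                  ; (suc i) → <-respʳ-≈ (sym (embed-· (v zero) j y (v (suc i)))) (yv i) }
        -- `z` outweighs `w` on `p` and the old constraints, while on `v zero` only `w` contributes.
        s , t , 0<s , 0<t , pos = dominate (λ i → z · forms i) (λ i → w · forms i) z-pos
        x′-pos : ∀ i → 0# < (s • z ⊕ t • w) · forms i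
        x′-pos i = <-respʳ-≈ (sym (·-linearˡ s z t w (forms i))) (pos i)
    in inj₁ (s • z ⊕ t • w , x′-pos zero ,
      λ { zero → <-respʳ-≈ (begin
            t * (w · v zero)                     ≈⟨ +-identityˡ _ ⟨
            0# + t * (w · v zero)                ≈⟨ +-congʳ (trans (*-congˡ (embed-⊥ (v zero) j y)) (zeroʳ s)) ⟨
            s * (z · v zero) + t * (w · v zero)  ≈⟨ ·-linearˡ s z t w (v zero) ⟨
            (s • z ⊕ t • w) · v zero             ∎) (*-pos 0<t wv₀)
        ; (suc i) → x′-pos (suc i) })

  -- Kirchberger's theorem with a fixed constraint, and the number of realised patterns.

  Realises : ∀ {D k} → Point D → (Fin k → Point D) → (Fin k → Bool) → Point D → Set ℓ₂
  Realises p q σ x = 0# < x · p × (∀ i → 0# < signed (σ i) (x · q i))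

  -- Negating the vectors of sign `false` turns every condition into positivity, so that `helly`
  -- applies.
  kirchberger : ∀ {D k} (p : Point D) (q : Fin k → Point D) (σ : Fin k → Bool) →
    ∃ (Realises p q σ) ⊎
    (∃[ Y ] ∣ Y ∣ ℕ.≤ D ×
      (∀ x → 0# < x · p → (∀ i → i ∈ Y → 0# < signed (σ i) (x · q i)) → ⊥))
  kirchberger p q σ with helly p (λ i → map (signed (σ i)) (q i))
  ... | inj₁ (x , xp , xq) =
    inj₁ (x , xp , λ i → <-respʳ-≈ (·-signed (σ i) x (q i)) (xq i))
  ... | inj₂ (Y , ∣Y∣≤ , inf) = inj₂ (Y , ∣Y∣≤ , λ x xp xq →
    inf x xp (λ i i∈Y → <-respʳ-≈ (sym (·-signed (σ i) x (q i))) (xq i i∈Y)))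

  -- Both outcomes of `kirchberger` carry certificates, hence `patterns` can be a Boolean family.
  realisable? : ∀ {D k} (p : Point D) (q : Fin k → Point D) σ → Dec (∃ (Realises p q σ))
  realisable? p q σ with kirchberger p q σ
  ... | inj₁ realised      = yes realised
  ... | inj₂ (_ , _ , inf) = no λ (x , xp , xq) → inf x xp (λ i _ → xq i)

  patterns : ∀ {D m} → Point D → (Fin m → Point D) → Family m
  patterns p q τ = does (realisable? p q (lookup τ))

  -- After homogenisation `D` is `suc d`, and the bound is then `η d (suc (suc m))`.
  count-patterns : ∀ {D m} (p : Point D) (q : Fin m → Point D) →
    count (patterns p q) ℕ.≤ binomials m D
  count-patterns {D} p q = sauer-shelah D (patterns p q) λ (ι , sh) →
    no-shattering p (λ i → q (ι i)) λ s →
      let τ , τ∈ , eq = sh s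
          x , xp , xq = does-true (realisable? p q (lookup τ)) τ∈
      in x , xp , λ i → ≡.subst (λ b → 0# < signed b (x · q (ι i))) (eq i) (xq (ι i))
    where
    does-true : ∀ {a} {A : Set a} (a? : Dec A) → does a? ≡ true → A
    does-true (yes a) _ = a

  -- Homogenisation: hyperplanes as linear forms in one more coordinate.

  ^_ : ∀ {d} → Point d → Point (suc d)
  ^ y = 1# ∷ y

  module Sides (t o : Carrier) where
    below : t < o → 0# < - (t + - o)
    below t<o = neg-pos (<-respʳ-≈ (-‿inverseʳ o) (+-monoˡ-< (- o) t<o))

    on : t ≈ o → t + - o ≈ 0#
    on t≈o = trans (+-congʳ t≈o) (-‿inverseʳ o)

    above : o < t → 0# < t + - o
    above o<t = <-respˡ-≈ (-‿inverseʳ o) (+-monoˡ-< (- o) o<t)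

    below⁻¹ : 0# < - (t + - o) → t < o
    below⁻¹ neg with compare t o
    ... | tri< t<o _ _ = t<o
    ... | tri≈ _ t≈o _ = contradiction (<-respʳ-≈ (trans (-‿cong (on t≈o)) -0#≈0#) neg) (irrefl refl)
    ... | tri> _ _ o<t = contradiction neg (¬pos-both (above o<t))

    on⁻¹ : t + - o ≈ 0# → t ≈ o
    on⁻¹ t-o≈0 with compare t o
    ... | tri< t<o _ _ = contradiction (<-respʳ-≈ (trans (-‿cong t-o≈0) -0#≈0#) (below t<o)) (irrefl refl)
    ... | tri≈ _ t≈o _ = t≈o
    ... | tri> _ _ o<t = contradiction (<-respʳ-≈ t-o≈0 (above o<t)) (irrefl refl)

    above⁻¹ : 0# < t + - o → o < t
    above⁻¹ pos with compare t o
    ... | tri< t<o _ _ = contradiction (below t<o) (¬pos-both pos)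
    ... | tri≈ _ t≈o _ = contradiction (<-respʳ-≈ (on t≈o) pos) (irrefl refl)
    ... | tri> _ _ o<t = o<t

  module _ {d : ℕ} (h : Hyperplane d) where
    open Hyperplane h
    module Side (y : Point d) = Sides (normal · y) offset

    form : Point (suc d)
    form = (- offset) ∷ normal

    form-· : ∀ y → form · ^ y ≈ normal · y + - offset
    form-· y = trans (+-congʳ (*-identityʳ _)) (+-comm _ _)

    -form-· : ∀ y → map -_ form · ^ y ≈ - (normal · y + - offset)
    -form-· y = begin
      map -_ form · ^ y          ≈⟨ ·-comm (map -_ form) (^ y) ⟩
      ^ y · map -_ form          ≈⟨ ·-signed false (^ y) form ⟩
      - (^ y · form)             ≈⟨ -‿cong (·-comm (^ y) form) ⟩
      - (form · ^ y)             ≈⟨ -‿cong (form-· y) ⟩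
      - (normal · y + - offset)  ∎

    -- A form and its negative describe the same hyperplane, so the one that is positive at `y` may
    -- be chosen.
    oriented : ∀ {y z} → Separates h y z →
      ∃[ x ] 0# < x · ^ y × 0# < - (x · ^ z) ×
        (∀ u → x · ^ u ≈ 0# → Contains h u) ×
        (∀ u w → 0# < x · ^ u → 0# < - (x · ^ w) → Separates h u w)
    oriented {y} {z} (inj₁ (y-above , z-below)) =
      form ,
      <-respʳ-≈ (sym (form-· y)) (Side.above y y-above) ,
      <-respʳ-≈ (-‿cong (sym (form-· z))) (Side.below z z-below) ,
      (λ u xu≈0 → Side.on⁻¹ u (trans (sym (form-· u)) xu≈0)) ,
      λ u w xu xw → inj₁
        ( Side.above⁻¹ u (<-respʳ-≈ (form-· u) xu)
        , Side.below⁻¹ w (<-respʳ-≈ (-‿cong (form-· w)) xw))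
    oriented {y} {z} (inj₂ (y-below , z-above)) =
      map -_ form ,
      <-respʳ-≈ (sym (-form-· y)) (Side.below y y-below) ,
      <-respʳ-≈ (sym (-[-form]-· z)) (Side.above z z-above) ,
      (λ u xu≈0 → Side.on⁻¹ u (trans (sym (-[-form]-· u)) (trans (-‿cong xu≈0) -0#≈0#))) ,
      λ u w xu xw → inj₂
        ( Side.below⁻¹ u (<-respʳ-≈ (-form-· u) xu)
        , Side.above⁻¹ w (<-respʳ-≈ (-[-form]-· w) xw))
      where
      -[-form]-· : ∀ u → - (map -_ form · ^ u) ≈ normal · u + - offset
      -[-form]-· u = trans (-‿cong (-form-· u)) (-‿involutive _)

  -- A form that changes sign is not constant on homogenised points, so its tail can serve as a
  -- normal vector.
  hyperplane : ∀ {d} (x : Point (suc d)) {y z : Point d} →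
    0# < x · ^ y → 0# < - (x · ^ z) →
    ∃[ h ] ∀ u → Hyperplane.normal h · u + - Hyperplane.offset h ≈ x · ^ u
  hyperplane x {y} {z} xy xz with nonzero-or-zero (tail x)
  ... | inj₁ nonzero = record { normal = tail x ; offset = - head x ; normal≉0 = nonzero } ,
    λ u → begin
      tail x · u + - - head x   ≈⟨ +-congˡ (-‿involutive _) ⟩
      tail x · u + head x       ≈⟨ +-comm _ _ ⟩
      head x + tail x · u       ≈⟨ +-congʳ (*-identityʳ _) ⟨
      x · ^ u                   ∎
  ... | inj₂ x≈0 = contradiction (<-respʳ-≈ (-‿cong (trans (constant z) (sym (constant y)))) xz) (¬pos-both xy)
    where
    constant : ∀ u → x · ^ u ≈ head x * 1#
    constant u = trans (+-congˡ (trans (·-comm (tail x) u) (·-zeroʳ u x≈0))) (+-identityʳ _)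

  -- Carries the sign at a representative over to another point of the same colour.
  signed-transfer : ∀ b {s t} → 0# < signed b s → ¬ t ≈ 0# →
    (0# < s → ¬ 0# < - t) → (0# < t → ¬ 0# < - s) → 0# < signed b t
  signed-transfer b {s} {t} pos t≉0 st ts with b | trichotomy t
  ... | _     | null t≈0      = contradiction t≈0 t≉0
  ... | true  | positive 0<t  = 0<t
  ... | true  | negative 0<-t = contradiction 0<-t (st pos)
  ... | false | positive 0<t  = contradiction pos (ts 0<t)
  ... | false | negative 0<-t = 0<-t

  signed-of-nonzero : ∀ {t} → ¬ t ≈ 0# → ∃[ b ] 0# < signed b t
  signed-of-nonzero {t} t≉0 with trichotomy t
  ... | positive 0<t  = true , 0<t
  ... | null t≈0      = contradiction t≈0 t≉0
  ... | negative 0<-t = false , 0<-t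

  -- Partitioning the whole point set along the colours.

  module _ {d m n : ℕ} (X : Fin n → Point d) (colour : Fin n → Fin (suc (suc m))) where

    -- The largest candidate family: conditions (1) and (3) hold by definition, and (2) can be
    -- treated one pair of points at a time. `Lift` only adjusts the universe level.
    Valid : Hyperplane d → Set (c ⊔ ℓ₁ ⊔ ℓ₂)
    Valid h = Lift c
      ((∀ i → ¬ Contains h (X i)) ×
       (∀ i j → colour i ≡ colour j → ¬ Separates h (X i) (X j)))

    module _
      (partition : ∀ S → ∣ S ∣ ℕ.≤ (d ℕ.+ 1) ℕ.* η d (suc (suc m)) ℕ.+ suc (suc m) →
                   CanBePartitioned X colour S)
      (i₀ j₀ : Fin n) (i₀≢j₀ : colour i₀ ≢ colour j₀) where

      -- `a` and `b` address the two colours to be separated, `b` by its index among the colours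
      -- other than `a`; `free` lists the remaining `m`.
      a = colour i₀
      b = punchOut i₀≢j₀

      free : Fin m → Fin (suc (suc m))
      free t = punchIn a (punchIn b t)

      signs : Vec Bool m → Fin (suc (suc m)) → Bool
      signs τ = insertAt (insertAt (lookup τ) b false) a true

      signs-elim : ∀ {p} (P : Fin (suc (suc m)) → Bool → Set p) τ →
        P a true → P (colour j₀) false → (∀ t → P (free t) (lookup τ t)) →
        ∀ c → P c (signs τ c)
      signs-elim P τ Pa Pb Pτ =
        insertAt-elim P _ a true Pa
          (insertAt-elim (λ c → P (punchIn a c)) (lookup τ) b false
            (≡.subst (λ c → P c false) (≡.sym (punchIn-punchOut i₀≢j₀)) Pb) Pτ)

      signs-a : ∀ τ → signs τ a ≡ true
      signs-a τ = insertAt-lookup (insertAt (lookup τ) b false) a true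

      signs-b : ∀ τ → signs τ (colour j₀) ≡ false
      signs-b τ = ≡.trans (≡.cong (signs τ) (≡.sym (punchIn-punchOut i₀≢j₀)))
        (≡.trans (insertAt-punchIn (insertAt (lookup τ) b false) a true b)
                 (insertAt-lookup (lookup τ) b false))

      -- A colour that does not occur gets the arbitrary value i₀.
      rep : Fin (suc (suc m)) → Fin n
      rep c with any? (λ i → colour i ≟ c)
      ... | yes (i , _) = i
      ... | no _        = i₀

      colour-rep : ∀ i → colour (rep (colour i)) ≡ colour i
      colour-rep i with any? (λ j → colour j ≟ colour i)
      ... | yes (_ , eq) = eq
      ... | no none      = contradiction (i , ≡.refl) none

      -- This constraint is common to all prescriptions, so it is counted once, among the
      -- representatives.
      pin : Point (suc d)
      pin = ^ X (rep a)

      -- The prescribed signs are strict and depend only on the colour, so the hyperplane avoids `X`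
      -- and respects every colour.
      realised⇒separable : ∀ τ → ∃ (Realises pin (λ i → ^ X i) (λ i → signs τ (colour i))) →
        ∃[ h ] Valid h × Separates h (X i₀) (X j₀)
      realised⇒separable τ (x , _ , pos) =
        h , lift (avoiding , respecting) ,
        inj₁ ( Side.above⁻¹ h (X i₀) (<-respʳ-≈ (sym (value (X i₀))) pos-i₀)
             , Side.below⁻¹ h (X j₀) (<-respʳ-≈ (-‿cong (sym (value (X j₀)))) pos-j₀))
        where
        pos-i₀ = ≡.subst (λ s → 0# < signed s (x · ^ X i₀)) (signs-a τ) (pos i₀)
        pos-j₀ = ≡.subst (λ s → 0# < signed s (x · ^ X j₀)) (signs-b τ) (pos j₀)
        h×value = hyperplane x pos-i₀ pos-j₀
        h = proj₁ h×value
        value = proj₂ h×value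

        avoiding : ∀ i → ¬ Contains h (X i)
        avoiding i contains = ¬signed-zero (signs τ (colour i))
            (trans (sym (value (X i))) (Side.on h (X i) contains)) (pos i)
          where
          ¬signed-zero : ∀ s {t} → t ≈ 0# → ¬ 0# < signed s t
          ¬signed-zero true  t≈0 0<t  = irrefl refl (<-respʳ-≈ t≈0 0<t)
          ¬signed-zero false t≈0 0<-t =
            irrefl refl (<-respʳ-≈ (trans (-‿cong t≈0) -0#≈0#) 0<-t)

        opposite : ∀ s {t u} → 0# < signed s t → 0# < signed s u → 0# < t → ¬ 0# < - u
        opposite true  _    0<u _   0<-u = ¬pos-both 0<u 0<-u
        opposite false 0<-t _   0<t _    = ¬pos-both 0<t 0<-t

        respecting : ∀ i j → colour i ≡ colour j → ¬ Separates h (X i) (X j)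
        respecting i j eq (inj₁ (above , below)) =
          opposite (signs τ (colour i)) (pos i)
            (≡.subst (λ c → 0# < signed (signs τ c) (x · ^ X j)) (≡.sym eq) (pos j))
            (<-respʳ-≈ (value (X i)) (Side.above h (X i) above))
            (<-respʳ-≈ (-‿cong (value (X j))) (Side.below h (X j) below))
        respecting i j eq (inj₂ (below , above)) =
          respecting j i (≡.sym eq) (inj₁ (above , below))

      Obstruction : Vec Bool m → Set (c ⊔ ℓ₂)
      Obstruction τ = ∃[ Y ] ∣ Y ∣ ℕ.≤ suc d ×
        (∀ x → 0# < x · pin →
          (∀ i → i ∈ Y → 0# < signed (signs τ (colour i)) (x · ^ X i)) → ⊥)

      module _ (obstruction : ∀ τ → Obstruction τ) where
        -- The sign at the representative of the colour of `j₀` is left free: this can only enlarge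
        -- the family, and just `m` forms remain to be counted.
        D : Family m
        D = patterns pin (λ t → ^ X (rep (free t)))

        Y : Vec Bool m → Subset n
        Y τ = proj₁ (obstruction τ)

        S : Subset n
        S = (⋃[ D ] Y) ∪ image rep

        ∣S∣≤ : ∣ S ∣ ℕ.≤ (d ℕ.+ 1) ℕ.* η d (suc (suc m)) ℕ.+ suc (suc m)
        ∣S∣≤ = ∣⋃∪image∣≤ D Y rep {d} (λ τ → proj₁ (proj₂ (obstruction τ)))
                 (count-patterns pin (λ t → ^ X (rep (free t))))

        -- A hyperplane partitioning `S` and separating the two representatives has signs `τ` at the
        -- free ones, so `τ` lies in `D` and `Y τ` in `S`. Each point of `S` takes the sign of its
        -- representative, contradicting the obstruction to `τ`.
        obstructions-absurd : ⊥
        obstructions-absurd =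
          obstructed x x-a (λ i i∈Y → x-Y i (p⊆p∪q _ (⊆-⋃ D Y τ τ∈D i∈Y)))
          where
          open PartitionsAlongColours (proj₂ (partition S ∣S∣≤))
          rep∈S : ∀ c → rep c ∈ S
          rep∈S c = q⊆p∪q (⋃[ D ] Y) _ (∈-image rep c)

          separated = separates (rep a) (rep (colour j₀)) (rep∈S a) (rep∈S (colour j₀))
            λ eq → i₀≢j₀ (≡.trans (≡.sym (colour-rep i₀)) (≡.trans eq (colour-rep j₀)))
          h = proj₁ separated
          h∈F = proj₁ (proj₂ separated)
          orientation = oriented h (proj₂ (proj₂ separated))
          x = proj₁ orientation
          x-a = proj₁ (proj₂ orientation)
          x-b = proj₁ (proj₂ (proj₂ orientation))
          on⇒contains = proj₁ (proj₂ (proj₂ (proj₂ orientation)))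
          opposite⇒separates = proj₂ (proj₂ (proj₂ (proj₂ orientation)))

          x≉0 : ∀ i → i ∈ S → ¬ x · ^ X i ≈ 0#
          x≉0 i i∈S xi≈0 = avoids h h∈F i i∈S (on⇒contains (X i) xi≈0)

          sign : ∀ t → ∃[ s ] 0# < signed s (x · ^ X (rep (free t)))
          sign t = signed-of-nonzero (x≉0 (rep (free t)) (rep∈S (free t)))

          -- The pattern is read off from the hyperplane; a colour that does not occur gets the sign
          -- at `i₀`.
          τ : Vec Bool m
          τ = Vec.tabulate (λ t → proj₁ (sign t))

          x-τ : ∀ t → 0# < signed (lookup τ t) (x · ^ X (rep (free t)))
          x-τ t = ≡.subst (λ s → 0# < signed s (x · ^ X (rep (free t))))
            (≡.sym (lookup∘tabulate (λ t → proj₁ (sign t)) t)) (proj₂ (sign t))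

          τ∈D : D τ ≡ true
          τ∈D = dec-true (realisable? pin _ (lookup τ)) (x , x-a , x-τ)

          obstructed = proj₂ (proj₂ (obstruction τ))

          x-rep : ∀ c → 0# < signed (signs τ c) (x · ^ X (rep c))
          x-rep = signs-elim (λ c s → 0# < signed s (x · ^ X (rep c))) τ x-a x-b x-τ

          x-Y : ∀ i → i ∈ S → 0# < signed (signs τ (colour i)) (x · ^ X i)
          x-Y i i∈S = signed-transfer (signs τ (colour i)) (x-rep (colour i)) (x≉0 i i∈S)
            (λ xr xi → respects h h∈F (rep (colour i)) i (rep∈S _) i∈S (colour-rep i)
              (opposite⇒separates _ _ xr xi))
            (λ xi xr → respects h h∈F i (rep (colour i)) i∈S (rep∈S _) (≡.sym (colour-rep i))
              (opposite⇒separates _ _ xi xr))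

      separable : ∃[ h ] Valid h × Separates h (X i₀) (X j₀)
      separable with search (λ τ → kirchberger pin (λ i → ^ X i) (λ i → signs τ (colour i)))
      ... | inj₁ (τ , realised) = realised⇒separable τ realised
      ... | inj₂ obstruction    = ⊥-elim (obstructions-absurd obstruction)

    partition-all :
      (∀ S → ∣ S ∣ ℕ.≤ (d ℕ.+ 1) ℕ.* η d (suc (suc m)) ℕ.+ suc (suc m) →
             CanBePartitioned X colour S) →
      CanBePartitioned X colour ⊤
    partition-all partition = Valid , record
      { avoids    = λ h (lift (avoids , _)) i _ → avoids i
      ; separates = λ i j _ _ i≢j → separable partition i j i≢j
      ; respects  = λ h (lift (_ , respects)) i j _ _ → respects i j
      }

open import Data.Nat.Base using (_+_; _*_; _≤_)

theorem4p2 : ∀ {c ℓ₁ ℓ₂} (ℝ : Reals c ℓ₁ ℓ₂) → let open Geometry ℝ in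
    (d k : ℕ) → 1 ≤ d → 2 ≤ k →
    (n : ℕ) (X : Fin n → Point d) → Injective _≡_ _≋_ X →
    (colour : Fin n → Fin k) →
    (∀ (S : Subset n) → ∣ S ∣ ≤ (d + 1) * η d k + k → CanBePartitioned X colour S) →
    CanBePartitioned X colour ⊤
theorem4p2 ℝ d (suc (suc m)) _ (s≤s (s≤s _)) n X _ colour = partition-all X colour
  where open LinearInequalities ℝ
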